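{- Let $D$ be a formula and $x_0$ a label. If the sequent $\vdash x_0:D$ is derivable in SeqCK (respectively, in SeqID), then it has a derivation in SeqCK (respectively, in SeqID) with no applications of the rules (Contr L) and (Contr R).
   Context: Formulas are built from propositional variables and $\bot$ by the binary connectives $\to$ and $\Rightarrow$. Fix a denumerable set $\mathcal{A}$ of labels. A labelled formula is $x:A$ and a transition formula is $x\xrightarrow{A}y$, with $x,y\in\mathcal{A}$ and $A$ a formula. A sequent $\Gamma\vdash\Delta$ is a pair of finite multisets of labelled and transition formulas. The calculi SeqCK and SeqID ($F$ is any labelled or transition formula): (AX) axiom $\Gamma,F\vdash\Delta,F$. (A$\bot$) axiom $\Gamma,x:\bot\vdash\Delta$. (Weak L) from $\Gamma\vdash\Delta$ infer $\Gamma,F\vdash\Delta$. (Weak R) from $\Gamma\vdash\Delta$ infer $\Gamma\vdash\Delta,F$. (Contr L) from $\Gamma,F,F\vdash\Delta$ infer $\Gamma,F\vdash\Delta$. (Contr R) from $\Gamma\vdash\Delta,F,F$ infer $\Gamma\vdash\Delta,F$. ($\to$R) from $\Gamma,x:A\vdash x:B,\Delta$ infer $\Gamma\vdash x:A\to B,\Delta$. ($\to$L) from $\Gamma\vdash x:A,\Delta$ and $\Gamma,x:B\vdash\Delta$ infer $\Gamma,x:A\to B\vdash\Delta$. (EQ) from $u:A\vdash u:B$ and $u:B\vdash u:A$ infer $\Gamma,x\xrightarrow{A}y\vdash x\xrightarrow{B}y,\Delta$. ($\Rightarrow$L) from $\Gamma\vdash x\xrightarrow{A}y,\Delta$ and $\Gamma,y:B\vdash\Delta$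 infer $\Gamma,x:A\Rightarrow B\vdash\Delta$. ($\Rightarrow$R) from $\Gamma,x\xrightarrow{A}y\vdash y:B,\Delta$ infer $\Gamma\vdash x:A\Rightarrow B,\Delta$, where the label $y$ does not occur in $\Gamma,\Delta$ and $y\neq x$. (ID) (only in SeqID) from $\Gamma,y:A\vdash\Delta$ infer $\Gamma,x\xrightarrow{A}y\vdash\Delta$. -}

module Defs where

open import Data.Empty using (⊥)
open import Data.List using (List; []; _∷_)
open import Data.List.Relation.Binary.Permutation.Propositional using (_↭_)
open import Data.List.Relation.Unary.All using (All)
open import Data.Product using (_×_)
open import Data.Sum using (_⊎_)
open import Data.Unit using (⊤)
open import Relation.Binary.PropositionalEquality using (_≡_; _≢_)
open import Relation.Nullary using (¬_)

infixr 7 _⟶_ _⇒_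
infix 6 _∶_ _-[_]→_

data Formula (Var : Set) : Set where
  atom    : Var → Formula Var
  falsum  : Formula Var
  _⟶_ _⇒_ : Formula Var → Formula Var → Formula Var

data LFormula (Var Label : Set) : Set where
  _∶_     : Label → Formula Var → LFormula Var Label
  _-[_]→_ : Label → Formula Var → Label → LFormula Var Label

data Calculus : Set where
  SeqCK SeqID : Calculus

module _ {Var Label : Set} where

  infix 3 _∣_⊢_

  Occurs : Label → LFormula Var Label → Set
  Occurs y (x ∶ A)        = y ≡ x
  Occurs y (x -[ A ]→ z)  = y ≡ x ⊎ y ≡ z

  Fresh : Label → List (LFormula Var Label) → Set
  Fresh y = All (λ F → ¬ Occurs y F)

  -- Finite multisets are lists up to permutation: `exch` only moves between
  -- lists that represent the same multisets, and the other constructors are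
  -- stated with the displayed formulas at the head.
  data _∣_⊢_ : Calculus → (Γ Δ : List (LFormula Var Label)) → Set where
    exch   : ∀ {S Γ Γ′ Δ Δ′} → Γ ↭ Γ′ → Δ ↭ Δ′ →
             S ∣ Γ ⊢ Δ → S ∣ Γ′ ⊢ Δ′
    ax     : ∀ {S Γ Δ F} → S ∣ F ∷ Γ ⊢ F ∷ Δ
    a⊥     : ∀ {S Γ Δ x} → S ∣ x ∶ falsum ∷ Γ ⊢ Δ
    weakL  : ∀ {S Γ Δ F} → S ∣ Γ ⊢ Δ → S ∣ F ∷ Γ ⊢ Δ
    weakR  : ∀ {S Γ Δ F} → S ∣ Γ ⊢ Δ → S ∣ Γ ⊢ F ∷ Δ
    contrL : ∀ {S Γ Δ F} → S ∣ F ∷ F ∷ Γ ⊢ Δ → S ∣ F ∷ Γ ⊢ Δ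
    contrR : ∀ {S Γ Δ F} → S ∣ Γ ⊢ F ∷ F ∷ Δ → S ∣ Γ ⊢ F ∷ Δ
    ⟶R     : ∀ {S Γ Δ x A B} →
             S ∣ x ∶ A ∷ Γ ⊢ x ∶ B ∷ Δ →
             S ∣ Γ ⊢ x ∶ A ⟶ B ∷ Δ
    ⟶L     : ∀ {S Γ Δ x A B} →
             S ∣ Γ ⊢ x ∶ A ∷ Δ →
             S ∣ x ∶ B ∷ Γ ⊢ Δ →
             S ∣ x ∶ A ⟶ B ∷ Γ ⊢ Δ
    eq     : ∀ {S Γ Δ x y u A B} →
             S ∣ u ∶ A ∷ [] ⊢ u ∶ B ∷ [] →
             S ∣ u ∶ B ∷ [] ⊢ u ∶ A ∷ [] →
             S ∣ x -[ A ]→ y ∷ Γ ⊢ x -[ B ]→ y ∷ Δ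
    ⇒L     : ∀ {S Γ Δ x y A B} →
             S ∣ Γ ⊢ x -[ A ]→ y ∷ Δ →
             S ∣ y ∶ B ∷ Γ ⊢ Δ →
             S ∣ x ∶ A ⇒ B ∷ Γ ⊢ Δ
    ⇒R     : ∀ {S Γ Δ x y A B} →
             Fresh y Γ → Fresh y Δ → y ≢ x →
             S ∣ x -[ A ]→ y ∷ Γ ⊢ y ∶ B ∷ Δ →
             S ∣ Γ ⊢ x ∶ A ⇒ B ∷ Δ
    idL    : ∀ {Γ Δ x y A} →
             SeqID ∣ y ∶ A ∷ Γ ⊢ Δ →
             SeqID ∣ x -[ A ]→ y ∷ Γ ⊢ Δ

  ContractionFree : ∀ {S Γ Δ} → S ∣ Γ ⊢ Δ → Set
  ContractionFree (exch _ _ d)  = ContractionFree d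
  ContractionFree ax            = ⊤
  ContractionFree a⊥            = ⊤
  ContractionFree (weakL d)     = ContractionFree d
  ContractionFree (weakR d)     = ContractionFree d
  ContractionFree (contrL _)    = ⊥
  ContractionFree (contrR _)    = ⊥
  ContractionFree (⟶R d)        = ContractionFree d
  ContractionFree (⟶L d e)      = ContractionFree d × ContractionFree e
  ContractionFree (eq d e)      = ContractionFree d × ContractionFree e
  ContractionFree (⇒L d e)      = ContractionFree d × ContractionFree e
  ContractionFree (⇒R _ _ _ d)  = ContractionFree d
  ContractionFree (idL d)       = ContractionFree d

{-# OPTIONS --safe #-}

-- The proof is semantic. A countermodel is a finite tree whose edges are labelled by formulas; an
-- edge labelled C is an A-transition when C and A are linked by a chain of interderivable
-- formulas of the full calculus. With this choice (EQ) is sound by construction, so the whole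
-- calculus, contractions included, is sound in such trees. Conversely, every sequent with a single
-- label has a contraction-free derivation or a tree countermodel, by induction on the modal depth:
-- the propositional rules are invertible, and a sequent of atoms and conditionals is derivable
-- only through one conditional C ⇒ D on the right, together with those A ⇒ B on the left for which
-- A is equivalent to C. Thus all conditionals but one on the right can be weakened away, and none
-- on the left is needed twice.
module Submission where

open import Defs
open import Data.Empty using (⊥; ⊥-elim)
open import Data.List using (List; []; _∷_; [_]; _++_; map)
open import Data.List.Membership.Propositional using (_∈_; _∉_; find; lose)
open import Data.List.Membership.Propositional.Properties using (∈-∃++)
open import Data.List.Properties using (map-++; ++-identityʳ)
open import Data.List.Relation.Binary.Permutation.Propositional
  using (_↭_; ↭-refl; ↭-sym; ↭-trans; ↭-reflexive; prep; swap)
open import Data.List.Relation.Binary.Permutation.Propositional.Properties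
  using (All-resp-↭; map⁺; shift)
open import Data.List.Relation.Unary.All as All using (All; []; _∷_)
open import Data.List.Relation.Unary.All.Properties using (++⁻ˡ; ++⁻ʳ)
  renaming (++⁺ to All-++⁺; map⁺ to All-map⁺)
open import Data.List.Relation.Unary.Any using (here; there; any?)
open import Data.Nat using (ℕ; zero; suc; _⊔_; _<_; s≤s) renaming (_≟_ to _≟ℕ_)
open import Data.Nat.Properties using (1+n≢n; n<1+n; m⊔n<o⇒m<o; m⊔n<o⇒n<o)
open import Data.Product using (Σ; ∃; _×_; _,_; proj₁; proj₂)
open import Data.Sum using (_⊎_; inj₁; inj₂)
open import Data.Unit using (tt)
open import Function using (_∘_)
open import Function.Bundles using (_↔_; Inverse)
open import Function.Properties.Inverse using (↔⇒↣)
open import Relation.Binary.Construct.Closure.ReflexiveTransitive using (Star; ε; _◅_; _◅◅_)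
open import Relation.Binary.Definitions using (DecidableEquality)
open import Relation.Binary.PropositionalEquality using (_≡_; _≢_; refl; sym; trans; cong; subst)
open import Relation.Nullary using (¬_; Dec; yes; no)
open import Relation.Nullary.Decidable using (map′; via-injection)

-- Modal depth and literals

depth : {Var : Set} → Formula Var → ℕ
depth (atom _) = 0
depth falsum   = 0
depth (A ⟶ B)  = depth A ⊔ depth B
depth (A ⇒ B)  = suc (depth A ⊔ depth B)

-- The strict bound falls on the components of a conditional, which puts them within reach of the
-- induction hypothesis. `falsum` is left out: it closes a sequent on the left and is weakened in on
-- the right.
data Literal {Var : Set} (n : ℕ) : Formula Var → Set where
  atom : ∀ p → Literal n (atom p)
  cond : ∀ {A B} → depth A < n → depth B < n → Literal n (A ⇒ B)

-- What a transition labelled C provides at its target.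
given : {Var : Set} → Calculus → Formula Var → List (Formula Var)
given SeqCK C = []
given SeqID C = [ C ]

∈-given : {Var : Set} {S : Calculus} {C : Formula Var} → S ≡ SeqID → C ∈ given S C
∈-given refl = here refl

All-given : {Var : Set} {P : Formula Var → Set} (S : Calculus) {C : Formula Var} →
            P C → All P (given S C)
All-given SeqCK pC = []
All-given SeqID pC = pC ∷ []

-- Contraction-free derivability

module _ {Var Label : Set} where

  infix 3 _∣_⊢ᶜᶠ_

  _∣_⊢ᶜᶠ_ : Calculus → (Γ Δ : List (LFormula Var Label)) → Set
  S ∣ Γ ⊢ᶜᶠ Δ = Σ (S ∣ Γ ⊢ Δ) ContractionFree

  exchᶜᶠ : ∀ {S Γ Γ′ Δ Δ′} → Γ ↭ Γ′ → Δ ↭ Δ′ → S ∣ Γ ⊢ᶜᶠ Δ → S ∣ Γ′ ⊢ᶜᶠ Δ′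
  exchᶜᶠ p q (d , c) = exch p q d , c

  weakLᶜᶠ : ∀ {S Γ Δ F} → S ∣ Γ ⊢ᶜᶠ Δ → S ∣ F ∷ Γ ⊢ᶜᶠ Δ
  weakLᶜᶠ (d , c) = weakL d , c

  weakRᶜᶠ : ∀ {S Γ Δ F} → S ∣ Γ ⊢ᶜᶠ Δ → S ∣ Γ ⊢ᶜᶠ F ∷ Δ
  weakRᶜᶠ (d , c) = weakR d , c

  ⟶Rᶜᶠ : ∀ {S Γ Δ x A B} → S ∣ x ∶ A ∷ Γ ⊢ᶜᶠ x ∶ B ∷ Δ → S ∣ Γ ⊢ᶜᶠ x ∶ A ⟶ B ∷ Δ
  ⟶Rᶜᶠ (d , c) = ⟶R d , c

  ⟶Lᶜᶠ : ∀ {S Γ Δ x A B} → S ∣ Γ ⊢ᶜᶠ x ∶ A ∷ Δ → S ∣ x ∶ B ∷ Γ ⊢ᶜᶠ Δ →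
          S ∣ x ∶ A ⟶ B ∷ Γ ⊢ᶜᶠ Δ
  ⟶Lᶜᶠ (d , c) (d′ , c′) = ⟶L d d′ , c , c′

  eqᶜᶠ : ∀ {S Γ Δ x y u A B} → S ∣ [ u ∶ A ] ⊢ᶜᶠ [ u ∶ B ] → S ∣ [ u ∶ B ] ⊢ᶜᶠ [ u ∶ A ] →
          S ∣ x -[ A ]→ y ∷ Γ ⊢ᶜᶠ x -[ B ]→ y ∷ Δ
  eqᶜᶠ (d , c) (d′ , c′) = eq d d′ , c , c′

  ⇒Lᶜᶠ : ∀ {S Γ Δ x y A B} → S ∣ Γ ⊢ᶜᶠ x -[ A ]→ y ∷ Δ → S ∣ y ∶ B ∷ Γ ⊢ᶜᶠ Δ →
          S ∣ x ∶ A ⇒ B ∷ Γ ⊢ᶜᶠ Δ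
  ⇒Lᶜᶠ (d , c) (d′ , c′) = ⇒L d d′ , c , c′

  ⇒Rᶜᶠ : ∀ {S Γ Δ x y A B} → Fresh y Γ → Fresh y Δ → y ≢ x →
          S ∣ x -[ A ]→ y ∷ Γ ⊢ᶜᶠ y ∶ B ∷ Δ → S ∣ Γ ⊢ᶜᶠ x ∶ A ⇒ B ∷ Δ
  ⇒Rᶜᶠ y∉Γ y∉Δ y≢x (d , c) = ⇒R y∉Γ y∉Δ y≢x d , c

  givenᶜᶠ : ∀ S {Γ Δ x y C} → S ∣ map (y ∶_) (given S C) ++ Γ ⊢ᶜᶠ Δ →
             S ∣ x -[ C ]→ y ∷ Γ ⊢ᶜᶠ Δ
  givenᶜᶠ SeqCK d       = weakLᶜᶠ d
  givenᶜᶠ SeqID (d , c) = idL d , c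

  fresh-∶ : {u y : Label} → y ≢ u → (Γ : List (Formula Var)) → Fresh y (map (u ∶_) Γ)
  fresh-∶ y≢u Γ = All-map⁺ (All.universal (λ _ → y≢u) Γ)

  axᶜᶠ : ∀ {S u} {A : Formula Var} {Γ Δ} → A ∈ Γ → A ∈ Δ →
          S ∣ map (u ∶_) Γ ⊢ᶜᶠ map (u ∶_) Δ
  axᶜᶠ A∈Γ A∈Δ with ∈-∃++ A∈Γ | ∈-∃++ A∈Δ
  ... | Γ₁ , Γ₂ , refl | Δ₁ , Δ₂ , refl =
    exchᶜᶠ (map⁺ _ (↭-sym (shift _ Γ₁ Γ₂))) (map⁺ _ (↭-sym (shift _ Δ₁ Δ₂))) (ax , tt)

-- Tree semantics

module _ {Var Label : Set} (S : Calculus) where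

  Interderivable : Formula Var → Formula Var → Set
  Interderivable A B =
    Σ Label λ u → (S ∣ [ u ∶ A ] ⊢ [ u ∶ B ]) × (S ∣ [ u ∶ B ] ⊢ [ u ∶ A ])

  infix 4 _~_ _⊨_ _⊩_

  -- Chains supply the transitivity that would otherwise call for cut; successive links may use
  -- different labels.
  _~_ : Formula Var → Formula Var → Set
  _~_ = Star Interderivable

  -- An atom holds at the root unless listed: forcing is then a negative condition, hence stable.
  data Tree : Set where
    node : List (Formula Var) → List (Formula Var × Tree) → Tree

  refuted : Tree → List (Formula Var)
  refuted (node Δ _) = Δ

  children : Tree → List (Formula Var × Tree)
  children (node _ cs) = cs

  _⊨_ : Tree → Formula Var → Set
  t ⊨ atom p = atom p ∉ refuted t
  t ⊨ falsum = ⊥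
  t ⊨ A ⟶ B  = t ⊨ A → t ⊨ B
  t ⊨ A ⇒ B  = ∀ {C s} → (C , s) ∈ children t → C ~ A → s ⊨ B

  -- Soundness refutes the right side instead of proving a disjunction. Stability turns a refuted
  -- refutation back into forcing, so the classical rules need no excluded middle.
  ⊨-stable : ∀ t A → ¬ ¬ t ⊨ A → t ⊨ A
  ⊨-stable t (atom p) h = λ p∈Δ → h (λ p∉Δ → p∉Δ p∈Δ)
  ⊨-stable t falsum   h = h (λ ())
  ⊨-stable t (A ⟶ B)  h = λ a → ⊨-stable t B λ ¬b → h λ f → ¬b (f a)
  ⊨-stable t (A ⇒ B)  h {s = s} s∈t C~A = ⊨-stable s B λ ¬b → h λ f → ¬b (f s∈t C~A)

  -- The semantic form of (ID), imposed at every node. It ranges over all formulas linked to the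
  -- edge label, because `idL` may meet any of them.
  data Good : Tree → Set where
    good : ∀ {Δ cs} → (∀ {C s} → (C , s) ∈ cs → Good s) →
           (S ≡ SeqID → ∀ {C s A} → (C , s) ∈ cs → C ~ A → s ⊨ A) →
           Good (node Δ cs)

  good-child : ∀ {t C s} → Good t → (C , s) ∈ children t → Good s
  good-child (good g _) = g

  good-id : ∀ {t C s A} → Good t → S ≡ SeqID → (C , s) ∈ children t → C ~ A → s ⊨ A
  good-id (good _ i) S≡ID = i S≡ID

  _⊩_ : (Label → Tree) → LFormula Var Label → Set
  ρ ⊩ x ∶ A       = ρ x ⊨ A
  ρ ⊩ x -[ A ]→ y = Σ (Formula Var) λ C → (C , ρ y) ∈ children (ρ x) × C ~ A

  -- Soundness of the full calculus

  module Soundness (_≟_ : DecidableEquality Label) where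

    _[_↦_] : (Label → Tree) → Label → Tree → Label → Tree
    (ρ [ y ↦ t ]) x with x ≟ y
    ... | yes _ = t
    ... | no  _ = ρ x

    update-≡ : ∀ ρ y t → (ρ [ y ↦ t ]) y ≡ t
    update-≡ ρ y t with y ≟ y
    ... | yes _  = refl
    ... | no y≢y = ⊥-elim (y≢y refl)

    update-≢ : ∀ ρ {y x} t → y ≢ x → (ρ [ y ↦ t ]) x ≡ ρ x
    update-≢ ρ {y} {x} t y≢x with x ≟ y
    ... | yes x≡y = ⊥-elim (y≢x (sym x≡y))
    ... | no _    = refl

    update-good : ∀ {ρ y t} → (∀ x → Good (ρ x)) → Good t → ∀ x → Good ((ρ [ y ↦ t ]) x)
    update-good {y = y} gρ gt x with x ≟ y
    ... | yes _ = gt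
    ... | no _  = gρ x

    ⊩-fresh : ∀ ρ {y} t F → ¬ Occurs y F → (ρ ⊩ F → ρ [ y ↦ t ] ⊩ F) × (ρ [ y ↦ t ] ⊩ F → ρ ⊩ F)
    ⊩-fresh ρ t (x ∶ A) y∉F rewrite update-≢ ρ t y∉F = (λ h → h) , (λ h → h)
    ⊩-fresh ρ t (x -[ A ]→ z) y∉F
      rewrite update-≢ ρ t (y∉F ∘ inj₁) | update-≢ ρ t (y∉F ∘ inj₂) = (λ h → h) , (λ h → h)

    sound : ∀ {Γ Δ} → S ∣ Γ ⊢ Δ → ∀ ρ → (∀ x → Good (ρ x)) →
            All (ρ ⊩_) Γ → All (λ F → ¬ ρ ⊩ F) Δ → ⊥
    sound (exch p q d) ρ g γ δ = sound d ρ g (All-resp-↭ (↭-sym p) γ) (All-resp-↭ (↭-sym q) δ)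
    sound ax ρ g (f ∷ _) (¬f ∷ _) = ¬f f
    sound a⊥ ρ g (f ∷ _) _ = f
    sound (weakL d) ρ g (_ ∷ γ) δ = sound d ρ g γ δ
    sound (weakR d) ρ g γ (_ ∷ δ) = sound d ρ g γ δ
    sound (contrL d) ρ g (f ∷ γ) δ = sound d ρ g (f ∷ f ∷ γ) δ
    sound (contrR d) ρ g γ (f ∷ δ) = sound d ρ g γ (f ∷ f ∷ δ)
    sound (⟶R {x = x} {B = B} d) ρ g γ (¬f ∷ δ) =
      ¬f λ a → ⊨-stable (ρ x) B λ ¬b → sound d ρ g (a ∷ γ) (¬b ∷ δ)
    sound (⟶L d e) ρ g (f ∷ γ) δ = sound d ρ g γ ((λ a → sound e ρ g (f a ∷ γ) δ) ∷ δ)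
    sound (eq {u = u} d e) ρ g ((C , c∈ , C~A) ∷ _) (¬f ∷ _) =
      -- The two premises form one more link at the end of the chain.
      ¬f (C , c∈ , C~A ◅◅ ((u , d , e) ◅ ε))
    sound (⇒L d e) ρ g (f ∷ γ) δ =
      sound d ρ g γ ((λ { (C , c∈ , C~A) → sound e ρ g (f c∈ C~A ∷ γ) δ }) ∷ δ)
    sound (⇒R {x = x} {y} {A} {B} y∉Γ y∉Δ y≢x d) ρ g γ (¬f ∷ δ) =
      ¬f λ {C} {s} s∈ C~A → ⊨-stable s B λ ¬b →
        -- The eigenvariable takes the child refuting `B` as its value; freshness leaves the context
        -- unaffected.
        sound d (ρ [ y ↦ s ]) (update-good g (good-child (g x) s∈))
          (transition s∈ C~A ∷ All.zipWith (λ { {F} (y∉F , f) → proj₁ (⊩-fresh ρ s F y∉F) f }) (y∉Γ , γ))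
          ((¬b ∘ subst (_⊨ B) (update-≡ ρ y s)) ∷
            All.zipWith (λ { {F} (y∉F , ¬f) → ¬f ∘ proj₂ (⊩-fresh ρ s F y∉F) }) (y∉Δ , δ))
      where
      transition : ∀ {C s} → (C , s) ∈ children (ρ x) → C ~ A → ρ [ y ↦ s ] ⊩ x -[ A ]→ y
      transition {C} {s} s∈ C~A rewrite update-≡ ρ y s | update-≢ ρ s y≢x = C , s∈ , C~A
    sound (idL {x = x} d) ρ g ((C , c∈ , C~A) ∷ γ) δ =
      sound d ρ g (good-id (g x) refl c∈ C~A ∷ γ) δ

    -- The valuation sending every label to `t` suits each link, whatever its label, so soundness
    -- applies link by link.
    ~-sound : ∀ {t A B} → Good t → A ~ B → (t ⊨ A → t ⊨ B) × (t ⊨ B → t ⊨ A)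
    ~-sound g ε = (λ h → h) , (λ h → h)
    ~-sound {t} g (_◅_ {i = A} {j = B} (u , d , e) B~C) =
      let f , f′ = ~-sound g B~C in
      (λ a → f (⊨-stable t B λ ¬b → sound d (λ _ → t) (λ _ → g) (a ∷ []) (¬b ∷ []))) ,
      (λ c → ⊨-stable t A λ ¬a → sound e (λ _ → t) (λ _ → g) (f′ c ∷ []) (¬a ∷ []))

  -- Propositional reduction to literals

  record Countermodel (Γ Δ : List (Formula Var)) : Set where
    constructor countermodel
    field
      tree      : Tree
      tree-good : Good tree
      forces    : All (tree ⊨_) Γ
      refutes   : All (λ A → ¬ tree ⊨ A) Δ

  -- Quantifying over the label spares a renaming lemma: `⇒R` needs its subderivation at a new
  -- label.
  Provable : (Γ Δ : List (Formula Var)) → Set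
  Provable Γ Δ = (u : Label) → S ∣ map (u ∶_) Γ ⊢ᶜᶠ map (u ∶_) Δ

  Decided : (Γ Δ : List (Formula Var)) → Set
  Decided Γ Δ = Provable Γ Δ ⊎ Countermodel Γ Δ

  decided-↭ : ∀ {Γ Γ′ Δ Δ′} → Γ ↭ Γ′ → Δ ↭ Δ′ → Decided Γ Δ → Decided Γ′ Δ′
  decided-↭ p q (inj₁ d) = inj₁ λ u → exchᶜᶠ (map⁺ _ p) (map⁺ _ q) (d u)
  decided-↭ p q (inj₂ (countermodel t g γ δ)) =
    inj₂ (countermodel t g (All-resp-↭ p γ) (All-resp-↭ q δ))

  -- Invertibility in semantic form: a countermodel of either premise is already one of the
  -- conclusion, so no copy of the principal formula has to be kept.
  decided-⟶L : ∀ {Γ Δ A B} → Decided Γ (A ∷ Δ) → Decided (B ∷ Γ) Δ → Decided (A ⟶ B ∷ Γ) Δ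
  decided-⟶L (inj₁ d) (inj₁ e) = inj₁ λ u → ⟶Lᶜᶠ (d u) (e u)
  decided-⟶L (inj₂ (countermodel t g γ (¬a ∷ δ))) _ =
    inj₂ (countermodel t g ((⊥-elim ∘ ¬a) ∷ γ) δ)
  decided-⟶L (inj₁ _) (inj₂ (countermodel t g (b ∷ γ) δ)) =
    inj₂ (countermodel t g ((λ _ → b) ∷ γ) δ)

  decided-⟶R : ∀ {Γ Δ A B} → Decided (A ∷ Γ) (B ∷ Δ) → Decided Γ (A ⟶ B ∷ Δ)
  decided-⟶R (inj₁ d) = inj₁ λ u → ⟶Rᶜᶠ (d u)
  decided-⟶R (inj₂ (countermodel t g (a ∷ γ) (¬b ∷ δ))) =
    inj₂ (countermodel t g γ ((λ f → ¬b (f a)) ∷ δ))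

  module _ {n : ℕ}
    (literals : ∀ {Γ Δ} → All (Literal n) Γ → All (Literal n) Δ → Decided Γ Δ) where

    -- `Γ′` and `Δ′` accumulate literals. Abstracting over them lets formulas be added one at a
    -- time, each by structural recursion.
    DecidedOver : (Γ Δ : List (Formula Var)) → Set
    DecidedOver Γ Δ = ∀ {Γ′ Δ′} → All (Literal n) Γ′ → All (Literal n) Δ′ →
                      Decided (Γ ++ Γ′) (Δ ++ Δ′)

    literalL : ∀ {A} Γ Δ → Literal n A → DecidedOver Γ Δ → DecidedOver (A ∷ Γ) Δ
    literalL Γ Δ a h {Γ′} γ δ = decided-↭ (shift _ Γ Γ′) ↭-refl (h (a ∷ γ) δ)

    literalR : ∀ {A} Γ Δ → Literal n A → DecidedOver Γ Δ → DecidedOver Γ (A ∷ Δ)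
    literalR Γ Δ a h {_} {Δ′} γ δ = decided-↭ ↭-refl (shift _ Δ Δ′) (h γ (a ∷ δ))

    mutual
      addL : ∀ A Γ Δ → depth A < suc n → DecidedOver Γ Δ → DecidedOver (A ∷ Γ) Δ
      addL (atom p) Γ Δ a<n h = literalL Γ Δ (atom p) h
      addL falsum   Γ Δ a<n h γ δ = inj₁ λ u → a⊥ , tt
      addL (A ⟶ B)  Γ Δ a<n h γ δ =
        decided-⟶L (addR A Γ Δ (m⊔n<o⇒m<o _ _ a<n) h γ δ)
                   (addL B Γ Δ (m⊔n<o⇒n<o (depth A) _ a<n) h γ δ)
      addL (A ⇒ B)  Γ Δ (s≤s a<n) h =
        literalL Γ Δ (cond (m⊔n<o⇒m<o _ _ a<n) (m⊔n<o⇒n<o (depth A) _ a<n)) h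

      addR : ∀ A Γ Δ → depth A < suc n → DecidedOver Γ Δ → DecidedOver Γ (A ∷ Δ)
      addR (atom p) Γ Δ a<n h = literalR Γ Δ (atom p) h
      addR falsum   Γ Δ a<n h γ δ with h γ δ
      ... | inj₁ d = inj₁ (weakRᶜᶠ ∘ d)
      ... | inj₂ (countermodel t g γ⊨ δ⊭) = inj₂ (countermodel t g γ⊨ ((λ h → h) ∷ δ⊭))
      addR (A ⟶ B)  Γ Δ a<n h γ δ =
        decided-⟶R (addL A Γ (B ∷ Δ) (m⊔n<o⇒m<o _ _ a<n)
                      (addR B Γ Δ (m⊔n<o⇒n<o (depth A) _ a<n) h) γ δ)
      addR (A ⇒ B)  Γ Δ (s≤s a<n) h =
        literalR Γ Δ (cond (m⊔n<o⇒m<o _ _ a<n) (m⊔n<o⇒n<o (depth A) _ a<n)) h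

    addAllL : ∀ {Γ Δ} → All (λ A → depth A < suc n) Γ → DecidedOver [] Δ → DecidedOver Γ Δ
    addAllL []        h = h
    addAllL {A ∷ Γ} {Δ} (a<n ∷ γ) h = addL A Γ Δ a<n (addAllL γ h)

    decide-step : ∀ {Γ A} → All (λ A → depth A < suc n) Γ → depth A < suc n → Decided Γ [ A ]
    decide-step {Γ} {A} γ a<n =
      subst (λ Γ → Decided Γ [ A ]) (++-identityʳ Γ)
        (addAllL γ (addR A [] [] a<n literals) [] [])

  -- The modal step and the induction on depth

  module Completeness (_≟V_ : DecidableEquality Var) (Label↔ℕ : Label ↔ ℕ) where

    open Inverse Label↔ℕ using (to; from; strictlyInverseˡ)
    open Soundness (via-injection (↔⇒↣ Label↔ℕ) _≟ℕ_)

    other : Label → Label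
    other u = from (suc (to u))

    other-≢ : ∀ u → other u ≢ u
    other-≢ u e = 1+n≢n (trans (sym (strictlyInverseˡ _)) (cong to e))

    atom? : ∀ p (A : Formula Var) → Dec (atom p ≡ A)
    atom? p (atom q) = map′ (cong atom) (λ { refl → refl }) (p ≟V q)
    atom? p falsum   = no λ ()
    atom? p (A ⟶ B)  = no λ ()
    atom? p (A ⇒ B)  = no λ ()

    AtomIn : List (Formula Var) → Formula Var → Set
    AtomIn Δ A = Σ Var λ p → A ≡ atom p × atom p ∈ Δ

    atomIn? : ∀ Δ A → Dec (AtomIn Δ A)
    atomIn? Δ (atom p) = map′ (λ p∈Δ → p , refl , p∈Δ) (λ { (_ , refl , p∈Δ) → p∈Δ }) (any? (atom? p) Δ)
    atomIn? Δ falsum   = no λ ()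
    atomIn? Δ (A ⟶ B)  = no λ ()
    atomIn? Δ (A ⇒ B)  = no λ ()

    module _ {n : ℕ}
      (decide : ∀ {Γ A} → All (λ A → depth A < n) Γ → depth A < n → Decided Γ [ A ]) where

      -- Contractions disappear here: a countermodel to either direction breaks every chain, even
      -- one whose links use contraction, since these are sound in it. Otherwise both directions
      -- have contraction-free proofs.
      equivalent? : ∀ {A C} → depth A < n → depth C < n →
        (Provable [ A ] [ C ] × Provable [ C ] [ A ]) ⊎ ¬ (C ~ A)
      equivalent? a<n c<n with decide (a<n ∷ []) c<n | decide (c<n ∷ []) a<n
      ... | inj₁ d | inj₁ e = inj₁ (d , e)
      ... | inj₂ (countermodel t g (a ∷ []) (¬c ∷ [])) | _ = inj₂ λ C~A → ¬c (proj₂ (~-sound g C~A) a)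
      ... | inj₁ _ | inj₂ (countermodel t g (c ∷ []) (¬a ∷ [])) = inj₂ λ C~A → ¬a (proj₁ (~-sound g C~A) c)

      -- What `Γ` says about the target of a C-transition. In `derive`, the context `Θ` carries the
      -- consequents released so far.
      record Selection (Γ : List (Formula Var)) (C : Formula Var) : Set where
        field
          consequents : List (Formula Var)
          bounded     : All (λ A → depth A < n) consequents
          complete    : ∀ {A B} → A ⇒ B ∈ Γ → C ~ A → B ∈ consequents
          derive      : ∀ {u y : Label} {Δ} Θ → S ∣ u -[ C ]→ y ∷ map (y ∶_) consequents ++ Θ ⊢ᶜᶠ Δ →
                        S ∣ u -[ C ]→ y ∷ map (u ∶_) Γ ++ Θ ⊢ᶜᶠ Δ

      open Selection

      skip : ∀ {Γ C F} → (∀ {A B} → A ⇒ B ≡ F → ¬ (C ~ A)) → Selection Γ C → Selection (F ∷ Γ) C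
      skip ≁F s .consequents = consequents s
      skip ≁F s .bounded     = bounded s
      skip ≁F s .complete (here e)  C~A = ⊥-elim (≁F e C~A)
      skip ≁F s .complete (there i) C~A = complete s i C~A
      skip ≁F s .derive Θ d = exchᶜᶠ (swap _ _ ↭-refl) ↭-refl (weakLᶜᶠ (derive s Θ d))

      take : ∀ {Γ A B C} → Provable [ A ] [ C ] → Provable [ C ] [ A ] → depth B < n →
             Selection Γ C → Selection (A ⇒ B ∷ Γ) C
      take {B = B} d e b<n s .consequents = B ∷ consequents s
      take d e b<n s .bounded = b<n ∷ bounded s
      take d e b<n s .complete (here refl) C~A = here refl
      take d e b<n s .complete (there i) C~A   = there (complete s i C~A)
      take {Γ} {B = B} {C} d e b<n s .derive {u} {y} Θ f =
        exchᶜᶠ (swap _ _ ↭-refl) ↭-refl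
          -- The transition passes to both premises: it closes the left one by (EQ) and remains in
          -- the right one for the other conditionals.
          (⇒Lᶜᶠ (eqᶜᶠ (e u) (d u))
            (exchᶜᶠ (move (map (u ∶_) Γ)) ↭-refl
              (derive s (y ∶ B ∷ Θ)
                (exchᶜᶠ (prep _ (↭-sym (shift _ (map (y ∶_) (consequents s)) Θ))) ↭-refl f))))
        where
        move : ∀ Ξ → u -[ C ]→ y ∷ Ξ ++ y ∶ B ∷ Θ ↭ y ∶ B ∷ u -[ C ]→ y ∷ Ξ ++ Θ
        move Ξ = ↭-trans (prep _ (shift _ Ξ Θ)) (swap _ _ ↭-refl)

      select : ∀ {Γ C} → All (Literal n) Γ → depth C < n → Selection Γ C
      select [] c<n = record
        { consequents = [] ; bounded = [] ; complete = λ () ; derive = λ Θ d → d }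
      select (atom p ∷ γ) c<n = skip (λ ()) (select γ c<n)
      select (cond a<n b<n ∷ γ) c<n with equivalent? a<n c<n
      ... | inj₁ (d , e) = take d e b<n (select γ c<n)
      ... | inj₂ ≁A      = skip (λ { refl → ≁A }) (select γ c<n)

      record Child (Γ : List (Formula Var)) (C : Formula Var) (t : Tree) : Set where
        constructor child
        field
          child-good : Good t
          child-id   : S ≡ SeqID → t ⊨ C
          child-cond : ∀ {A B} → A ⇒ B ∈ Γ → C ~ A → t ⊨ B

      open Child

      -- The question moves to the target of a C-transition: do `given S C` and the selected
      -- consequents yield `D`? A countermodel there becomes a child with edge label `C`.
      decide-cond : ∀ {Γ C D} → All (Literal n) Γ → depth C < n → depth D < n →
        (∀ Δ → Provable Γ (C ⇒ D ∷ Δ)) ⊎ Σ Tree (λ t → Child Γ C t × ¬ t ⊨ D)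
      decide-cond {Γ} {C} {D} γ c<n d<n
        with decide (All-++⁺ (All-given S c<n) (bounded (select γ c<n))) d<n
      ... | inj₁ d = inj₁ λ Δ u →
        -- Read from the root: weaken away `Δ`, apply `⇒R`, spend the conditionals of `Γ`, then
        -- trade the transition for `given S C`.
        let y  = other u
            s  = select γ c<n
            d₁ = exchᶜᶠ (↭-reflexive (trans (map-++ (y ∶_) (given S C) (consequents s))
                                            (cong (map (y ∶_) (given S C) ++_) (sym (++-identityʳ _)))))
                        ↭-refl (d y)
            d₂ = exchᶜᶠ (prep _ (↭-reflexive (++-identityʳ _))) ↭-refl
                        (derive s {u} [] (givenᶜᶠ S d₁))
        in weakenR (map (u ∶_) Δ) (⇒Rᶜᶠ (fresh-∶ (other-≢ u) Γ) [] (other-≢ u) d₂)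
        where
        weakenR : ∀ {Γ F} Δ → S ∣ Γ ⊢ᶜᶠ [ F ] → S ∣ Γ ⊢ᶜᶠ F ∷ Δ
        weakenR []      d = d
        weakenR (G ∷ Δ) d = exchᶜᶠ ↭-refl (swap _ _ ↭-refl) (weakRᶜᶠ (weakenR Δ d))
      ... | inj₂ (countermodel t g h (¬d ∷ [])) =
        inj₂ (t , child g (λ S≡ID → All.lookup (++⁻ˡ (given S C) h) (∈-given S≡ID))
                        (λ i C~A → All.lookup (++⁻ʳ (given S C) h) (complete (select γ c<n) i C~A))
                , ¬d)

      -- One provable conditional settles the sequent; failing that, each conditional on the right
      -- contributes a child.
      decide-conds : ∀ {Γ Δ} → All (Literal n) Γ → All (Literal n) Δ →
        Provable Γ Δ ⊎
        Σ (List (Formula Var × Tree)) λ cs →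
          (∀ {C t} → (C , t) ∈ cs → Child Γ C t) ×
          (∀ {C D} → C ⇒ D ∈ Δ → ∃ λ t → (C , t) ∈ cs × ¬ t ⊨ D)
      decide-conds γ [] = inj₂ ([] , (λ ()) , (λ ()))
      decide-conds γ (l ∷ δ) with decide-conds γ δ
      ... | inj₁ d = inj₁ (weakRᶜᶠ ∘ d)
      decide-conds γ (atom p ∷ δ) | inj₂ (cs , ok , fails) =
        inj₂ (cs , ok , λ { (there i) → fails i })
      decide-conds γ (cond c<n d<n ∷ δ) | inj₂ (cs , ok , fails) with decide-cond γ c<n d<n
      ... | inj₁ d = inj₁ (d _)
      ... | inj₂ (t , t-ok , ¬d) = inj₂
        ( (_ , t) ∷ cs
        , (λ { (here refl) → t-ok ; (there i) → ok i })
        , λ { (here refl) → t , here refl , ¬d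
            ; (there i) → let s , s∈ , ¬s = fails i in s , there s∈ , ¬s })

      decide-literals : ∀ {Γ Δ} → All (Literal n) Γ → All (Literal n) Δ → Decided Γ Δ
      decide-literals {Γ} {Δ} γ δ with any? (atomIn? Δ) Γ
      ... | yes clash with find clash
      ...   | _ , p∈Γ , _ , refl , p∈Δ = inj₁ λ u → axᶜᶠ p∈Γ p∈Δ
      decide-literals {Γ} {Δ} γ δ | no disjoint with decide-conds γ δ
      ... | inj₁ d = inj₁ d
      ... | inj₂ (cs , ok , fails) = inj₂ (countermodel (node Δ cs)
        (good (child-good ∘ ok)
              -- A child is built to force its own edge label; linked formulas follow because the
              -- child is good.
              (λ S≡ID c∈ C~A → proj₁ (~-sound (child-good (ok c∈)) C~A) (child-id (ok c∈) S≡ID)))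
        (All.tabulate λ i → forced i (All.lookup γ i))
        (All.tabulate λ i → refused i (All.lookup δ i)))
        where
        forced : ∀ {A} → A ∈ Γ → Literal n A → node Δ cs ⊨ A
        forced i (atom p)   p∈Δ    = disjoint (lose i (p , refl , p∈Δ))
        forced i (cond _ _) c∈ C~A = child-cond (ok c∈) i C~A

        refused : ∀ {A} → A ∈ Δ → Literal n A → ¬ node Δ cs ⊨ A
        refused i (atom p)   h = h i
        -- The empty chain makes an edge labelled C a C-transition.
        refused i (cond _ _) h = let t , t∈ , ¬d = fails i in ¬d (h t∈ ε)

    decide : ∀ n {Γ A} → All (λ A → depth A < n) Γ → depth A < n → Decided Γ [ A ]
    decide zero    γ ()
    decide (suc n) γ a<n = decide-step (decide-literals (decide n)) γ a<n

    -- The given derivation is not transformed: by soundness it rules out the countermodel.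
    contraction-free : ∀ D x₀ → S ∣ [] ⊢ [ x₀ ∶ D ] → S ∣ [] ⊢ᶜᶠ [ x₀ ∶ D ]
    contraction-free D x₀ d with decide (suc (depth D)) [] (n<1+n (depth D))
    ... | inj₁ e = e x₀
    ... | inj₂ (countermodel t g [] (¬D ∷ [])) =
      ⊥-elim (sound d (λ _ → t) (λ _ → g) [] (¬D ∷ []))

theorem4p21 : (Var Label : Set) → DecidableEquality Var → Label ↔ ℕ →
    (S : Calculus) (D : Formula Var) (x₀ : Label) →
    S ∣ [] ⊢ [ x₀ ∶ D ] → Σ (S ∣ [] ⊢ [ x₀ ∶ D ]) ContractionFree
theorem4p21 Var Label _≟V_ Label↔ℕ S = Completeness.contraction-free S _≟V_ Label↔ℕ
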